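{- Let $G$ and $H$ be graphs without isolated vertices. Then the Kronecker double coverings $K_2 \times G$ and $K_2 \times H$ are isomorphic as graphs if and only if the box complexes $B(G)$ and $B(H)$ are isomorphic as posets (ignoring the involutions).
   Context: A graph $G$ is a set $V(G)$ together with a symmetric subset $E(G) \subset V(G)\times V(G)$ (undirected, no multiple edges, loops allowed; graphs may be infinite). For $v \in V(G)$, $N(v)=\{w : (v,w)\in E(G)\}$; $v$ is isolated if $N(v)=\emptyset$. $K_2$ is the graph with $V(K_2)=\{1,2\}$ and $E(K_2)=\{(1,2),(2,1)\}$. The (tensor) product $G\times H$ has vertex set $V(G)\times V(H)$, with $((x,y),(x',y'))$ an edge iff $(x,x')\in E(G)$ and $(y,y')\in E(H)$; $K_2\times G$ is the Kronecker double covering of $G$. The box complex $B(G)$ is the poset of all pairs $(\sigma,\tau)$ of non-empty (possibly infinite) subsets of $V(G)$ with $\sigma\times\tau\subset E(G)$, ordered by $(\sigma,\tau)\le(\sigma',\tau')$ iff $\sigma\subset\sigma'$ and $\tau\subset\tau'$, and equipped with the involution $(\sigma,\tau)\leftrightarrow(\tau,\sigma)$. -}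

module Defs where

open import Data.Fin.Base using (Fin; zero; suc)
open import Data.Product.Base using (_×_; _,_; uncurry)
open import Data.Product.Relation.Binary.Pointwise.NonDependent using (×-poset)
open import Function.Bundles using (_⇔_; _↔_; Inverse)
open import Level using (Level; 0ℓ; _⊔_) renaming (suc to lsuc)
open import Relation.Binary.Bundles using (Poset)
open import Relation.Binary.Core using (Rel)
open import Relation.Binary.Definitions using (Symmetric)
import Relation.Binary.Construct.On as On
open import Relation.Binary.Morphism.Structures using (IsOrderIsomorphism)
open import Relation.Nullary.Negation.Core using (¬_)
open import Relation.Unary using (Pred; Empty; Satisfiable; _⊆_; _⟨×⟩_)
open import Relation.Unary.Relation.Binary.Subset using (⊆-poset)

private
  variable
    a b c d e f : Level

record Graph (a : Level) : Set (lsuc a) where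
  field
    V   : Set a
    E   : Rel V a
    sym : Symmetric E

  N : V → Pred V a
  N v w = E v w

  Isolated : Pred V a
  Isolated v = Empty (N v)

open Graph public using (V; E)

NoIsolatedVertices : Graph a → Set a
NoIsolatedVertices G = ∀ v → ¬ Graph.Isolated G v

-- E may have several inhabitants at a given pair; only its inhabitedness
-- matters, so edges are compared by logical equivalence.
record _≅ᴳ_ (G : Graph a) (H : Graph b) : Set (a ⊔ b) where
  field
    vertices : V G ↔ V H
    edges    : ∀ v w → E G v w ⇔ E H (Inverse.to vertices v) (Inverse.to vertices w)

infix 4 _≅ᴳ_

-- The vertices 1 and 2 are represented by the two elements of Fin 2.
data K₂-Edge : Rel (Fin 2) 0ℓ where
  e₁₂ : K₂-Edge zero (suc zero)
  e₂₁ : K₂-Edge (suc zero) zero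

K₂ : Graph 0ℓ
K₂ = record { V = Fin 2 ; E = K₂-Edge ; sym = λ { e₁₂ → e₂₁ ; e₂₁ → e₁₂ } }

_×ᴳ_ : Graph a → Graph b → Graph (a ⊔ b)
G ×ᴳ H = record
  { V   = V G × V H
  ; E   = λ (x , y) (x′ , y′) → E G x x′ × E H y y′
  ; sym = λ (p , q) → Graph.sym G p , Graph.sym H q
  }

infixr 6 _×ᴳ_

-- Subsets are predicates at the universe level of the graph.  Under excluded
-- middle at that level this is the full power set: every such predicate is
-- decidable, hence extensionally equal to a Bool-valued one.
record Biclique {a} (G : Graph a) : Set (lsuc a) where
  field
    σ τ        : Pred (V G) a
    σ-nonempty : Satisfiable σ
    τ-nonempty : Satisfiable τ
    complete   : (σ ⟨×⟩ τ) ⊆ uncurry (E G)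

-- The underlying equality is extensional equality of both components, so the
-- nonemptiness and completeness witnesses are not compared.  The involution
-- exchanging σ and τ is not part of the poset structure.
BoxComplex : Graph a → Poset (lsuc a) a a
BoxComplex {a} G =
  On.poset (×-poset (⊆-poset (V G) a) (⊆-poset (V G) a))
           (λ (B : Biclique G) → Biclique.σ B , Biclique.τ B)

record _≅ᴾ_ (P : Poset a b c) (Q : Poset d e f) : Set (a ⊔ b ⊔ c ⊔ d ⊔ e ⊔ f) where
  private
    module P = Poset P
    module Q = Poset Q
  field
    to                 : P.Carrier → Q.Carrier
    isOrderIsomorphism : IsOrderIsomorphism P._≈_ Q._≈_ P._≤_ Q._≤_ to

infix 4 _≅ᴾ_

{-# OPTIONS --safe #-}

-- A biclique (σ , τ) of G amounts to a subset {1} × σ ∪ {2} × τ of K₂ × G, so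
-- an isomorphism of double coverings transports bicliques; the image is again a
-- biclique because in K₂ × G an edge joins opposite sides and a common
-- neighbour forces equal sides.  Conversely, the minimal elements of B(G) are
-- the edges of K₂ × G, and two of them share an endpoint iff they have an upper
-- bound with no further minimal element below it.  So a poset isomorphism is an
-- isomorphism of line graphs.  As K₂ × G is bipartite, it maps the star of each
-- vertex into a star, and the side of the new centre is either always kept or
-- always exchanged along a connected component.

module Submission where

open import Defs
open import Axiom.ExcludedMiddle using (ExcludedMiddle)
open import Data.Bool.Base using (Bool; true; false; if_then_else_)
open import Data.Empty using (⊥-elim)
open import Data.Fin.Base using (Fin; zero; suc; opposite)
open import Data.Fin.Properties using (opposite-involutive)
open import Data.Product.Base using (∃; _×_; _,_; proj₁; proj₂)
open import Data.Sum.Base as Sum using (_⊎_; inj₁; inj₂; [_,_]′)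
open import Function.Base using (id; _∘_)
open import Function.Bundles
  using (_⇔_; Equivalence; Inverse; mk⇔; mk↔ₛ′)
import Function.Consequences.Setoid as Consequences
import Function.Construct.Symmetry as Symmetry
open import Level using (Level; _⊔_)
open import Relation.Binary.Bundles using (Poset; Setoid)
open import Relation.Binary.Morphism.Structures using (IsOrderIsomorphism)
open import Relation.Binary.PropositionalEquality
  using (_≡_; refl; sym; trans; cong; subst; subst₂; module ≡-Reasoning)
open import Relation.Nullary.Decidable.Core using (yes; no; does)
open import Relation.Nullary.Decidable using (does-⇔)
open import Relation.Nullary.Negation.Core using (¬_)
open import Relation.Unary using (Pred; _∈_; _⊆′_)

private
  variable
    a b ℓ ℓ₁ ℓ₂ ℓ₃ ℓ₄ : Level

-- The two sides of a double covering.

K₂-opposite : ∀ i → K₂-Edge i (opposite i)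
K₂-opposite zero       = e₁₂
K₂-opposite (suc zero) = e₂₁

K₂-sym : ∀ {i j} → K₂-Edge i j → K₂-Edge j i
K₂-sym = Graph.sym K₂

K₂-opposite⁻¹ : ∀ {i j} → K₂-Edge i j → j ≡ opposite i
K₂-opposite⁻¹ e₁₂ = refl
K₂-opposite⁻¹ e₂₁ = refl

K₂-functional : ∀ {i j k} → K₂-Edge i j → K₂-Edge i k → j ≡ k
K₂-functional p q = trans (K₂-opposite⁻¹ p) (sym (K₂-opposite⁻¹ q))

-- Later arguments carry a pair of opposite sides as `K₂-Edge i j` and split cases relative to it,
-- so both choices of `i` are treated at once.
K₂-cover : ∀ {i j} → K₂-Edge i j → ∀ k → k ≡ i ⊎ k ≡ j
K₂-cover e₁₂ zero       = inj₁ refl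
K₂-cover e₁₂ (suc zero) = inj₂ refl
K₂-cover e₂₁ zero       = inj₂ refl
K₂-cover e₂₁ (suc zero) = inj₁ refl

-- Graph isomorphisms and order isomorphisms.

≅ᴳ-from-homs : {G : Graph a} {H : Graph b}
  (f : V G → V H) (g : V H → V G) →
  (∀ q → f (g q) ≡ q) → (∀ p → g (f p) ≡ p) →
  (∀ {p q} → E G p q → E H (f p) (f q)) →
  (∀ {p q} → E H p q → E G (g p) (g q)) → G ≅ᴳ H
≅ᴳ-from-homs {G = G} f g fg gf f-hom g-hom = record
  { vertices = mk↔ₛ′ f g fg gf
  ; edges    = λ p q → mk⇔ f-hom (subst₂ (E G) (gf p) (gf q) ∘ g-hom)
  }

module GraphIso {G : Graph a} {H : Graph b} (I : G ≅ᴳ H) where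
  open _≅ᴳ_ I
  open Inverse vertices public using (to; from)
    renaming (strictlyInverseˡ to to∘from; strictlyInverseʳ to from∘to)

  to-hom : ∀ {p q} → E G p q → E H (to p) (to q)
  to-hom = Equivalence.to (edges _ _)

  from-hom : ∀ {p q} → E H p q → E G (from p) (from q)
  from-hom {p} {q} pq =
    Equivalence.from (edges _ _) (subst₂ (E H) (sym (to∘from p)) (sym (to∘from q)) pq)

≅ᴳ-sym : {G : Graph a} {H : Graph b} → G ≅ᴳ H → H ≅ᴳ G
≅ᴳ-sym I = ≅ᴳ-from-homs from to from∘to to∘from from-hom to-hom
  where open GraphIso I

module _ {P : Poset a ℓ₁ ℓ₂} {Q : Poset b ℓ₃ ℓ₄} where
  private
    module P = Poset P
    module Q = Poset Q

  ≅ᴾ-from-monos : (f : P.Carrier → Q.Carrier) (g : Q.Carrier → P.Carrier) →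
    (∀ {x y} → x P.≤ y → f x Q.≤ f y) → (∀ {x y} → x Q.≤ y → g x P.≤ g y) →
    (∀ y → f (g y) Q.≈ y) → (∀ x → g (f x) P.≈ x) → P ≅ᴾ Q
  ≅ᴾ-from-monos f g f-mono g-mono fg gf = record
    { to                 = f
    ; isOrderIsomorphism = record
      { isOrderMonomorphism = record
        { isOrderHomomorphism = record { cong = f-cong ; mono = f-mono }
        ; injective = λ fx≈fy → P.antisym
            (f-cancel (Q.reflexive fx≈fy)) (f-cancel (Q.reflexive (Q.Eq.sym fx≈fy)))
        ; cancel    = f-cancel
        }
      ; surjective = λ y → g y , λ z≈gy → Q.Eq.trans (f-cong z≈gy) (fg y)
      }
    }
    where
    f-cong : ∀ {x y} → x P.≈ y → f x Q.≈ f y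
    f-cong x≈y = Q.antisym (f-mono (P.reflexive x≈y)) (f-mono (P.reflexive (P.Eq.sym x≈y)))

    f-cancel : ∀ {x y} → f x Q.≤ f y → x P.≤ y
    f-cancel {x} {y} fx≤fy =
      P.trans (P.reflexive (P.Eq.sym (gf x))) (P.trans (g-mono fx≤fy) (P.reflexive (gf y)))

module PosetIso {P : Poset a ℓ₁ ℓ₂} {Q : Poset b ℓ₃ ℓ₄} (I : P ≅ᴾ Q) where
  private
    module P = Poset P
    module Q = Poset Q
  open _≅ᴾ_ I public
  open IsOrderIsomorphism isOrderIsomorphism public using (mono; injective; cancel; surjective)

  from : Q.Carrier → P.Carrier
  from y = proj₁ (surjective y)

  to∘from : ∀ y → to (from y) Q.≈ y
  to∘from y = proj₂ (surjective y) P.Eq.refl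

  from∘to : ∀ x → from (to x) P.≈ x
  from∘to x = injective (to∘from (to x))

  to-≤⇒≤-from : ∀ {x y} → to x Q.≤ y → x P.≤ from y
  to-≤⇒≤-from p = cancel (Q.trans p (Q.reflexive (Q.Eq.sym (to∘from _))))

  ≤-to⇒from-≤ : ∀ {x y} → y Q.≤ to x → from y P.≤ x
  ≤-to⇒from-≤ p = cancel (Q.trans (Q.reflexive (to∘from _)) p)

  ≤-from⇒to-≤ : ∀ {x y} → x P.≤ from y → to x Q.≤ y
  ≤-from⇒to-≤ p = Q.trans (mono p) (Q.reflexive (to∘from _))

  from-≤⇒≤-to : ∀ {x y} → from y P.≤ x → y Q.≤ to x
  from-≤⇒≤-to p = Q.trans (Q.reflexive (Q.Eq.sym (to∘from _))) (mono p)

  from-mono : ∀ {x y} → x Q.≤ y → from x P.≤ from y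
  from-mono p = to-≤⇒≤-from (Q.trans (Q.reflexive (to∘from _)) p)

≅ᴾ-sym : {P : Poset a ℓ₁ ℓ₂} {Q : Poset b ℓ₃ ℓ₄} → P ≅ᴾ Q → Q ≅ᴾ P
≅ᴾ-sym I = ≅ᴾ-from-monos from to from-mono mono from∘to to∘from
  where open PosetIso I

-- From double coverings to box complexes

module _ {G : Graph a} where
  open Poset (BoxComplex G) using (_≤_)

  members : Biclique G → Pred (V (K₂ ×ᴳ G)) a
  members B (zero     , v) = v ∈ Biclique.σ B
  members B (suc zero , v) = v ∈ Biclique.τ B

  members-mono : ∀ {B C} → B ≤ C → members B ⊆′ members C
  members-mono (σ⊆ , τ⊆) (zero     , v) = σ⊆
  members-mono (σ⊆ , τ⊆) (suc zero , v) = τ⊆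

  members-cancel : ∀ {B C} → members B ⊆′ members C → B ≤ C
  members-cancel B⊆C = (λ {v} → B⊆C (zero , v)) , (λ {v} → B⊆C (suc zero , v))

  -- Members on opposite sides are adjacent by completeness; members on the same side are both
  -- adjacent to any vertex of the other, nonempty side. The conclusion speaks of adjacency only, so
  -- it survives an isomorphism that exchanges sides.
  adjacent-or-common-neighbour : ∀ B {p q} → p ∈ members B → q ∈ members B →
    E (K₂ ×ᴳ G) p q ⊎ ∃ λ r → E (K₂ ×ᴳ G) r p × E (K₂ ×ᴳ G) r q
  adjacent-or-common-neighbour B {zero , _} {zero , _} p∈ q∈ =
    let t , t∈ = Biclique.τ-nonempty B in
    inj₂ ((suc zero , t) , (e₂₁ , Graph.sym G (Biclique.complete B (p∈ , t∈)))
                         , (e₂₁ , Graph.sym G (Biclique.complete B (q∈ , t∈))))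
  adjacent-or-common-neighbour B {zero , _} {suc zero , _} p∈ q∈ =
    inj₁ (e₁₂ , Biclique.complete B (p∈ , q∈))
  adjacent-or-common-neighbour B {suc zero , _} {zero , _} p∈ q∈ =
    inj₁ (e₂₁ , Graph.sym G (Biclique.complete B (q∈ , p∈)))
  adjacent-or-common-neighbour B {suc zero , _} {suc zero , _} p∈ q∈ =
    let s , s∈ = Biclique.σ-nonempty B in
    inj₂ ((zero , s) , (e₁₂ , Biclique.complete B (s∈ , p∈))
                     , (e₁₂ , Biclique.complete B (s∈ , q∈)))

module _ {G H : Graph ℓ} (I : K₂ ×ᴳ G ≅ᴳ K₂ ×ᴳ H) where
  open GraphIso I

  transport : Biclique G → Biclique H
  transport B = record
    { σ          = λ w → members B (from (zero , w))
    ; τ          = λ w → members B (from (suc zero , w))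
    ; σ-nonempty = proj₁ nonempty
    ; τ-nonempty = proj₂ nonempty
    ; complete   = λ (w∈ , w′∈) → complete′ w∈ w′∈
    }
    where
    image : ∀ {p} → p ∈ members B → members B (from (to p))
    image = subst (members B) (sym (from∘to _))

    nonempty : (∃ λ w → members B (from (zero , w))) ×
               (∃ λ w → members B (from (suc zero , w)))
    nonempty
      with s , s∈ ← Biclique.σ-nonempty B
         | t , t∈ ← Biclique.τ-nonempty B
      -- An edge inside the biclique has an image with one end on each side, which gives both
      -- witnesses; which end serves which side depends on whether the isomorphism exchanges the
      -- sides here.
      with to (zero , s) | to (suc zero , t) | to-hom (e₁₂ , Biclique.complete B (s∈ , t∈))
         | image {zero , s} s∈ | image {suc zero , t} t∈
    ... | _ | _ | e₁₂ , _ | s′∈ | t′∈ = (_ , s′∈) , (_ , t′∈)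
    ... | _ | _ | e₂₁ , _ | s′∈ | t′∈ = (_ , t′∈) , (_ , s′∈)

    E-to : ∀ {p q} → E (K₂ ×ᴳ G) p (from q) → E (K₂ ×ᴳ H) (to p) q
    E-to = subst (E (K₂ ×ᴳ H) _) (to∘from _) ∘ to-hom

    complete′ : ∀ {w w′} → members B (from (zero , w)) → members B (from (suc zero , w′)) →
      E H w w′
    complete′ w∈ w′∈ with adjacent-or-common-neighbour B w∈ w′∈
    ... | inj₁ pq = proj₂ (subst₂ (E (K₂ ×ᴳ H)) (to∘from _) (to∘from _) (to-hom pq))
    -- The image of `r` would be adjacent to vertices on both sides.
    ... | inj₂ (r , rp , rq)
      with () ← K₂-functional (proj₁ (E-to rp)) (proj₁ (E-to rq))

  members-transport : ∀ B p → members (transport B) p ≡ members B (from p)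
  members-transport B (zero     , _) = refl
  members-transport B (suc zero , _) = refl

  transport-mono : ∀ {B C} → Poset._≤_ (BoxComplex G) B C →
                   Poset._≤_ (BoxComplex H) (transport B) (transport C)
  transport-mono {B} {C} B≤C = members-cancel {B = transport B} {transport C}
    (λ p → subst₂ (λ X Y → X → Y)
      (sym (members-transport B p)) (sym (members-transport C p))
      (members-mono {B = B} {C} B≤C (from p)))

transport-inverse : {G H : Graph ℓ} (I : K₂ ×ᴳ G ≅ᴳ K₂ ×ᴳ H) → ∀ B →
  Poset._≈_ (BoxComplex G) (transport (≅ᴳ-sym I) (transport I B)) B
transport-inverse {G = G} I B = Poset.antisym (BoxComplex G) {B′} {B}
  (members-cancel {B = B′} {B} (λ p → subst id (members-B′ p)))
  (members-cancel {B = B} {B′} (λ p → subst id (sym (members-B′ p))))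
  where
  open GraphIso I
  J = ≅ᴳ-sym I
  B′ = transport J (transport I B)

  members-B′ : ∀ p → members B′ p ≡ members B p
  members-B′ p = trans (members-transport J (transport I B) p)
    (trans (members-transport I B (to p)) (cong (members B) (from∘to p)))

box-complexes-isomorphic : {G H : Graph ℓ} →
  K₂ ×ᴳ G ≅ᴳ K₂ ×ᴳ H → BoxComplex G ≅ᴾ BoxComplex H
box-complexes-isomorphic I = ≅ᴾ-from-monos (transport I) (transport J)
  (λ {B} {C} → transport-mono I {B} {C}) (λ {B} {C} → transport-mono J {B} {C})
  (transport-inverse J) (transport-inverse I)
  where J = ≅ᴳ-sym I

-- Edges of the double covering

-- An undirected edge of `K₂ ×ᴳ G` is an ordered adjacent pair of `G`: `left` lies on side `zero`,
-- `right` on side `suc zero`.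
record Edge (G : Graph a) : Set a where
  constructor edge
  field
    left right : V G
    link       : E G left right

  end : Fin 2 → V G
  end zero       = left
  end (suc zero) = right

open Edge

module _ {G : Graph a} where

  Share : Fin 2 → Edge G → Edge G → Set a
  Share i e f = end e i ≡ end f i

  _≋_ : Edge G → Edge G → Set a
  e ≋ f = ∀ i → Share i e f

  -- Adjacency in the line graph of `K₂ ×ᴳ G`, made reflexive. Endpoints on different sides are
  -- distinct vertices, so only equal sides are compared.
  Meet : Edge G → Edge G → Set a
  Meet e f = ∃ λ i → Share i e f

  ≋-from-sides : ∀ {i j e f} → K₂-Edge i j → Share i e f → Share j e f → e ≋ f
  ≋-from-sides {e = e} {f} ij p q k with K₂-cover ij k
  ... | inj₁ refl = p
  ... | inj₂ refl = q

  endpoint : Edge G → Fin 2 → V (K₂ ×ᴳ G)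
  endpoint e i = i , end e i

  endpoints-adjacent : ∀ e {i j} → K₂-Edge i j → E (K₂ ×ᴳ G) (endpoint e i) (endpoint e j)
  endpoints-adjacent e e₁₂ = e₁₂ , link e
  endpoints-adjacent e e₂₁ = e₂₁ , Graph.sym G (link e)

  edge-between : ∀ {i j v w} → E (K₂ ×ᴳ G) (i , v) (j , w) → Edge G
  edge-between {v = v} {w} (e₁₂ , vw) = edge v w vw
  edge-between {v = v} {w} (e₂₁ , vw) = edge w v (Graph.sym G vw)

  edge-between-source : ∀ {p q} (pq : E (K₂ ×ᴳ G) p q) →
    endpoint (edge-between pq) (proj₁ p) ≡ p
  edge-between-source (e₁₂ , _) = refl
  edge-between-source (e₂₁ , _) = refl

  edge-between-target : ∀ {p q} (pq : E (K₂ ×ᴳ G) p q) →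
    endpoint (edge-between pq) (proj₁ q) ≡ q
  edge-between-target (e₁₂ , _) = refl
  edge-between-target (e₂₁ , _) = refl

edges : Graph a → Setoid a a
edges G = record
  { Carrier       = Edge G
  ; _≈_           = _≋_
  ; isEquivalence = record
    { refl  = λ _ → refl
    ; sym   = λ p i → sym (p i)
    ; trans = λ p q i → trans (p i) (q i)
    }
  }

record LineIso (G : Graph a) (H : Graph b) : Set (a ⊔ b) where
  field
    inverse : Inverse (edges G) (edges H)

  open Inverse inverse public using (to; from; to-cong; from-cong)
    renaming (strictlyInverseˡ to to∘from; strictlyInverseʳ to from∘to)

  field
    to-meet   : ∀ {e f} → Meet e f → Meet (to e) (to f)
    from-meet : ∀ {e f} → Meet e f → Meet (from e) (from f)

  to-reflects-meet : ∀ {e f} → Meet (to e) (to f) → Meet e f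
  to-reflects-meet {e} {f} m =
    let i , s = from-meet m in i , trans (sym (from∘to e i)) (trans s (from∘to f i))

  to-injective : ∀ {e f} → to e ≋ to f → e ≋ f
  to-injective {e} {f} p i =
    trans (sym (from∘to e i)) (trans (from-cong p i) (from∘to f i))

LineIso-sym : {G : Graph a} {H : Graph b} → LineIso G H → LineIso H G
LineIso-sym L = record
  { inverse = Symmetry.inverse inverse ; to-meet = from-meet ; from-meet = to-meet }
  where open LineIso L

-- From line graphs to double coverings

module _ {G H : Graph ℓ} (L : LineIso G H) where
  open LineIso L

  -- The isomorphism exchanges the two sides at e.  The definition is symmetric
  -- in the two graphs, so it applies verbatim to the inverse.
  Twisted : Edge G → Set ℓ
  Twisted e = ∃ λ f → ∃ λ i → ∃ λ j →
    K₂-Edge i j × ¬ (e ≋ f) × Share i e f × Share j (to e) (to f)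

  Twisted-≋ : ∀ {e f} → e ≋ f → Twisted e → Twisted f
  Twisted-≋ e≋f (g , i , j , ij , e≉g , s , t) =
    g , i , j , ij , (λ f≋g → e≉g (λ k → trans (e≋f k) (f≋g k)))
      , trans (sym (e≋f i)) s , trans (sym (to-cong e≋f j)) t

  -- If the witness g and f relate to e in a way inconsistent with the claim,
  -- comparing f with g forces two of the three edges to coincide.
  Twisted-share : ∀ {e f i j} → Twisted e → K₂-Edge i j → Share i e f → Share j (to e) (to f)
  Twisted-share {e} {f} {i} {j} (g , k , l , kl , e≉g , s , t) ij eif
    with to-meet (i , eif)
  ... | m , tm with K₂-cover ij m
  ... | inj₂ refl = tm
  ... | inj₁ refl with K₂-cover ij k
  ...   | inj₁ refl
    with refl ← K₂-functional ij kl
    with to-meet {f} {g} (i , trans (sym eif) s)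
  ...     | n , tn with K₂-cover ij n
  ...       | inj₁ refl = ⊥-elim (e≉g (to-injective (≋-from-sides ij (trans tm tn) t)))
  ...       | inj₂ refl = trans t (sym tn)
  Twisted-share {e} {f} {i} {j} (g , k , l , kl , e≉g , s , t) ij eif
      | m , tm | inj₁ refl | inj₂ refl
    with refl ← K₂-functional (K₂-sym ij) kl
    with to-reflects-meet {f} {g} (i , trans (sym tm) t)
  ...     | n , tn with K₂-cover ij n
  ...       | inj₁ refl = ⊥-elim (e≉g (≋-from-sides ij (trans eif tn) s))
  ...       | inj₂ refl = to-cong (≋-from-sides ij eif (trans s (sym tn))) j

-- The image of the witness is a witness for the inverse, with the two sides trading roles.
Twisted-sym : {G H : Graph ℓ} (L : LineIso G H) → ∀ {e} →
  Twisted L e → Twisted (LineIso-sym L) (LineIso.to L e)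
Twisted-sym L {e} (f , i , j , ij , e≉f , s , t) =
  to f , j , i , K₂-sym ij , e≉f ∘ to-injective , t
    , trans (from∘to e i) (trans s (sym (from∘to f i)))
  where open LineIso L

-- The vertex map induced by an isomorphism of line graphs.

module VertexMap (em : ExcludedMiddle ℓ) where

  -- The hypothesis only refutes that there is no neighbour; excluded middle turns this into an
  -- actual one.
  edgeAt : {G : Graph ℓ} → NoIsolatedVertices G → V (K₂ ×ᴳ G) → Edge G
  edgeAt {G} nonisolated (i , v) with em {∃ λ w → E G v w}
  ... | no isolated = ⊥-elim (nonisolated v (λ w vw → isolated (w , vw)))
  edgeAt {G} _ (zero     , v) | yes (w , vw) = edge v w vw
  edgeAt {G} _ (suc zero , v) | yes (w , vw) = edge w v (Graph.sym G vw)

  end-edgeAt : {G : Graph ℓ} (n : NoIsolatedVertices G) → ∀ i v →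
    end (edgeAt {G} n (i , v)) i ≡ v
  end-edgeAt {G} n i v with em {∃ λ w → E G v w}
  ... | no isolated = ⊥-elim (n v (λ w vw → isolated (w , vw)))
  end-edgeAt {G} n zero       v | yes _ = refl
  end-edgeAt {G} n (suc zero) v | yes _ = refl

  flipIf : Bool → Fin 2 → Fin 2
  flipIf b = if b then opposite else id

  flipIf-involutive : ∀ b i → flipIf b (flipIf b i) ≡ i
  flipIf-involutive false i = refl
  flipIf-involutive true  i = opposite-involutive i

  flipIf-K₂ : ∀ b {i j} → K₂-Edge i j → K₂-Edge (flipIf b i) (flipIf b j)
  flipIf-K₂ false ij  = ij
  flipIf-K₂ true  e₁₂ = e₂₁
  flipIf-K₂ true  e₂₁ = e₁₂

  module _ {G H : Graph ℓ} (L : LineIso G H) where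
    open LineIso L

    twisted : Edge G → Bool
    twisted e = does (em {Twisted L e})

    -- For distinct edges the images still meet somewhere, and meeting on the opposite side would
    -- make `f` a witness of `Twisted`.
    untwisted-share : ∀ {e f i} → ¬ Twisted L e → Share i e f → Share i (to e) (to f)
    untwisted-share {e} {f} {i} untwisted eif with em {e ≋ f}
    ... | yes e≋f = to-cong e≋f i
    ... | no  e≉f with to-meet (i , eif)
    ...   | j , s with K₂-cover (K₂-opposite i) j
    ...     | inj₁ refl = s
    ...     | inj₂ refl = ⊥-elim (untwisted (f , i , j , K₂-opposite i , e≉f , eif , s))

    to-share : ∀ {e f i} → Share i e f → Share (flipIf (twisted e) i) (to e) (to f)
    to-share {e} {i = i} s with em {Twisted L e}
    ... | yes t = Twisted-share L t (K₂-opposite i) s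
    ... | no ¬t = untwisted-share {i = i} ¬t s

    -- Unless the edges coincide, `e` itself is the witness at `f`. Hence twisting is constant along
    -- a connected component.
    Twisted-along : ∀ {e f i} → Share i e f → Twisted L e → Twisted L f
    Twisted-along {e} {f} {i} s t with em {e ≋ f}
    ... | yes e≋f = Twisted-≋ L e≋f t
    ... | no  e≉f = e , i , opposite i , K₂-opposite i , (λ f≋e → e≉f (sym ∘ f≋e)) , sym s
                  , sym (Twisted-share L t (K₂-opposite i) s)

    twisted-share : ∀ {e f i} → Share i e f → twisted e ≡ twisted f
    twisted-share {i = i} s = does-⇔
      (mk⇔ (Twisted-along {i = i} s) (Twisted-along {i = i} (sym s))) em em

    image : Edge G → Fin 2 → V (K₂ ×ᴳ H)
    image e i = endpoint (to e) (flipIf (twisted e) i)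

    -- This makes the vertex map independent of the edge chosen at a vertex: the images of `e` and
    -- `f` agree on the flipped side, and both edges use the same flip.
    image-share : ∀ {e f i} → Share i e f → image e i ≡ image f i
    image-share {e} {f} {i} s = trans
      (cong (flipIf (twisted e) i ,_) (to-share {i = i} s))
      (cong (λ b → endpoint (to f) (flipIf b i)) (twisted-share {i = i} s))

    vertexMap : NoIsolatedVertices G → V (K₂ ×ᴳ G) → V (K₂ ×ᴳ H)
    vertexMap n p = image (edgeAt n p) (proj₁ p)

    vertexMap-endpoint : ∀ n e i → vertexMap n (endpoint e i) ≡ image e i
    vertexMap-endpoint n e i = image-share {i = i} (end-edgeAt n i (end e i))

    -- The images of `p` and `q` can both be computed from the edge joining them, and so are the two
    -- ends of its image.
    vertexMap-hom : ∀ n {p q} → E (K₂ ×ᴳ G) p q →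
      E (K₂ ×ᴳ H) (vertexMap n p) (vertexMap n q)
    vertexMap-hom n {p} {q} pq = subst₂ (E (K₂ ×ᴳ H))
      (trans (sym (vertexMap-endpoint n e (proj₁ p)))
        (cong (vertexMap n) (edge-between-source pq)))
      (trans (sym (vertexMap-endpoint n e (proj₁ q)))
        (cong (vertexMap n) (edge-between-target pq)))
      (endpoints-adjacent (to e) (flipIf-K₂ (twisted e) (proj₁ pq)))
      where e = edge-between pq

  twisted-to : {G H : Graph ℓ} (L : LineIso G H) → ∀ e →
    twisted (LineIso-sym L) (LineIso.to L e) ≡ twisted L e
  twisted-to L e = does-⇔
    -- In this direction `Twisted-sym` arrives at `from (to e)`, which is then replaced by `e`.
    (mk⇔ (Twisted-≋ L (from∘to e) ∘ Twisted-sym (LineIso-sym L)) (Twisted-sym L)) em em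
    where open LineIso L

  -- By `twisted-to` both maps flip by the same Boolean, so the flips cancel.
  vertexMap-inverse : {G H : Graph ℓ} (L : LineIso G H)
    (m : NoIsolatedVertices G) (n : NoIsolatedVertices H) → ∀ p →
    vertexMap (LineIso-sym L) n (vertexMap L m p) ≡ p
  vertexMap-inverse L m n p@(i , v) = begin
    vertexMap M n (endpoint (to e) j)              ≡⟨ vertexMap-endpoint M n (to e) j ⟩
    endpoint (from (to e)) (flipIf (twisted M (to e)) j)
      ≡⟨ cong (λ b → endpoint (from (to e)) (flipIf b j)) (twisted-to L e) ⟩
    endpoint (from (to e)) (flipIf (twisted L e) j)
      ≡⟨ cong (endpoint (from (to e))) (flipIf-involutive (twisted L e) i) ⟩
    endpoint (from (to e)) i                       ≡⟨ cong (i ,_) (from∘to e i) ⟩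
    endpoint e i                                   ≡⟨ cong (i ,_) (end-edgeAt m i v) ⟩
    p                                              ∎
    where
    open ≡-Reasoning
    open LineIso L
    M = LineIso-sym L
    e = edgeAt m p
    j = flipIf (twisted L e) i

  double-coverings-isomorphic : {G H : Graph ℓ} →
    NoIsolatedVertices G → NoIsolatedVertices H → LineIso G H → K₂ ×ᴳ G ≅ᴳ K₂ ×ᴳ H
  double-coverings-isomorphic m n L = ≅ᴳ-from-homs (vertexMap L m) (vertexMap M n)
    (vertexMap-inverse M n m) (vertexMap-inverse L m n)
    (vertexMap-hom L m) (vertexMap-hom M n)
    where M = LineIso-sym L

-- From box complexes to line graphs

module _ (P : Poset a ℓ₁ ℓ₂) where
  open Poset P

  Minimal : Pred Carrier (a ⊔ ℓ₂)
  Minimal x = ∀ y → y ≤ x → x ≤ y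

  -- The order-theoretic counterpart of `Meet`, to be applied to atoms; an order isomorphism
  -- preserves it.
  Close : Carrier → Carrier → Set (a ⊔ ℓ₂)
  Close x y = ∃ λ z → x ≤ z × y ≤ z × (∀ {m} → Minimal m → m ≤ z → m ≤ x ⊎ m ≤ y)

module _ {P : Poset a ℓ₁ ℓ₂} {Q : Poset b ℓ₃ ℓ₄} (I : P ≅ᴾ Q) where
  open PosetIso I

  Minimal-to : ∀ {x} → Minimal P x → Minimal Q (to x)
  Minimal-to min y y≤ = ≤-from⇒to-≤ (min (from y) (≤-to⇒from-≤ y≤))

Minimal-from : {P : Poset a ℓ₁ ℓ₂} {Q : Poset b ℓ₃ ℓ₄} (I : P ≅ᴾ Q) → ∀ {y} →
  Minimal Q y → Minimal P (PosetIso.from I y)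
Minimal-from I = Minimal-to (≅ᴾ-sym I)

Close-to : {P : Poset a ℓ₁ ℓ₂} {Q : Poset b ℓ₃ ℓ₄} (I : P ≅ᴾ Q) → ∀ {x y} →
  Close P x y → Close Q (PosetIso.to I x) (PosetIso.to I y)
Close-to I (z , x≤z , y≤z , only) = to z , mono x≤z , mono y≤z ,
  λ min m≤ → Sum.map from-≤⇒≤-to from-≤⇒≤-to (only (Minimal-from I min) (≤-to⇒from-≤ m≤))
  where open PosetIso I

Close-cong : (P : Poset a ℓ₁ ℓ₂) → let open Poset P in ∀ {x x′ y y′} →
  x ≈ x′ → y ≈ y′ → Close P x y → Close P x′ y′
Close-cong P x≈x′ y≈y′ (z , x≤z , y≤z , only) =
  z , P.trans (P.reflexive (P.Eq.sym x≈x′)) x≤z , P.trans (P.reflexive (P.Eq.sym y≈y′)) y≤z ,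
  λ min m≤z → Sum.map (λ p → P.trans p (P.reflexive x≈x′)) (λ p → P.trans p (P.reflexive y≈y′))
    (only min m≤z)
  where module P = Poset P

-- Minimal elements of the box complex.

module _ {G : Graph a} where
  private module B = Poset (BoxComplex G)

  atom : Edge G → Biclique G
  atom e = record
    { σ          = _≡ left e
    ; τ          = _≡ right e
    ; σ-nonempty = left e , refl
    ; τ-nonempty = right e , refl
    ; complete   = λ { (refl , refl) → link e }
    }

  edgeIn : Biclique G → Edge G
  edgeIn B =
    let s , s∈ = Biclique.σ-nonempty B
        t , t∈ = Biclique.τ-nonempty B
    in edge s t (Biclique.complete B (s∈ , t∈))

  atom-edgeIn-≤ : ∀ B → atom (edgeIn B) B.≤ B
  atom-edgeIn-≤ B = (λ { refl → proj₂ (Biclique.σ-nonempty B) })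
                  , (λ { refl → proj₂ (Biclique.τ-nonempty B) })

  atom-mono : ∀ {e f} → e ≋ f → atom e B.≤ atom f
  atom-mono e≋f = (λ { refl → e≋f zero }) , (λ { refl → e≋f (suc zero) })

  atom-cancel : ∀ {e f} → atom e B.≤ atom f → e ≋ f
  atom-cancel (σ⊆ , τ⊆) zero       = σ⊆ refl
  atom-cancel (σ⊆ , τ⊆) (suc zero) = τ⊆ refl

  -- A nonempty subset of a singleton is the whole singleton.
  atom-minimal : ∀ e → Minimal (BoxComplex G) (atom e)
  atom-minimal e B (σ⊆ , τ⊆) =
    (λ { refl → subst (Biclique.σ B) (σ⊆ s∈) s∈ }) ,
    (λ { refl → subst (Biclique.τ B) (τ⊆ t∈) t∈ })
    where
    s∈ = proj₂ (Biclique.σ-nonempty B)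
    t∈ = proj₂ (Biclique.τ-nonempty B)

  -- Every biclique lies above an atom, so a minimal one equals it. With `atom-minimal`, the minimal
  -- elements are exactly the edges.
  atom-edgeIn : ∀ {B} → Minimal (BoxComplex G) B → atom (edgeIn B) B.≈ B
  atom-edgeIn {B} min = B.antisym {atom (edgeIn B)} {B}
    (atom-edgeIn-≤ B) (min (atom (edgeIn B)) (atom-edgeIn-≤ B))

  -- The upper bound is the componentwise union. As one component is a singleton, the only edges in
  -- it are `e` and `f`.
  Meet⇒Close : ∀ {e f} → Meet e f → Close (BoxComplex G) (atom e) (atom f)
  Meet⇒Close {e} {f} meet =
    e∪f , (inj₁ , inj₁) , (inj₂ , inj₂) , λ {m} min m≤ → only {m} min m≤ meet
    where
    complete : Meet e f → ∀ {x y} → x ≡ left e ⊎ x ≡ left f →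
      y ≡ right e ⊎ y ≡ right f → E G x y
    complete _              (inj₁ refl) (inj₁ refl) = link e
    complete _              (inj₂ refl) (inj₂ refl) = link f
    -- In a mixed pair the shared endpoint may be read as belonging to either edge, which turns the
    -- pair into `e` or `f`.
    complete (zero     , s) (inj₁ refl) (inj₂ refl) = subst (λ v → E G v _) (sym s) (link f)
    complete (suc zero , s) (inj₁ refl) (inj₂ refl) = subst (E G _) s (link e)
    complete (zero     , s) (inj₂ refl) (inj₁ refl) = subst (λ v → E G v _) s (link e)
    complete (suc zero , s) (inj₂ refl) (inj₁ refl) = subst (E G _) (sym s) (link f)

    e∪f : Biclique G
    e∪f = record
      { σ          = λ x → x ≡ left e ⊎ x ≡ left f
      ; τ          = λ y → y ≡ right e ⊎ y ≡ right f
      ; σ-nonempty = left e , inj₁ refl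
      ; τ-nonempty = right e , inj₁ refl
      ; complete   = λ (x∈ , y∈) → complete meet x∈ y∈
      }

    only : ∀ {m} → Minimal (BoxComplex G) m → m B.≤ e∪f → Meet e f →
      m B.≤ atom e ⊎ m B.≤ atom f
    only {m} min (σ⊆ , τ⊆) meet = Sum.map below below (choose meet s∈ t∈)
      where
      g = edgeIn m
      s∈ = σ⊆ (proj₂ (Biclique.σ-nonempty m))
      t∈ = τ⊆ (proj₂ (Biclique.τ-nonempty m))

      below : ∀ {h} → g ≋ h → m B.≤ atom h
      below {h} g≋h = B.trans {m} {atom g} {atom h}
        (min (atom g) (atom-edgeIn-≤ m)) (atom-mono g≋h)

      choose : Meet e f → left g ≡ left e ⊎ left g ≡ left f →
        right g ≡ right e ⊎ right g ≡ right f → g ≋ e ⊎ g ≋ f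
      -- On the shared side `g` agrees with both edges; its other end decides between them.
      choose (zero , s) l (inj₁ r) =
        inj₁ (≋-from-sides e₁₂ ([ id , (λ p → trans p (sym s)) ]′ l) r)
      choose (zero , s) l (inj₂ r) =
        inj₂ (≋-from-sides e₁₂ ([ (λ p → trans p s) , id ]′ l) r)
      choose (suc zero , s) (inj₁ l) r =
        inj₁ (≋-from-sides e₁₂ l ([ id , (λ p → trans p (sym s)) ]′ r))
      choose (suc zero , s) (inj₂ l) r =
        inj₂ (≋-from-sides e₁₂ l ([ (λ p → trans p s) , id ]′ r))

  -- The bound also contains the cross edge from `left e` to `right f`. Its atom is minimal, hence
  -- below that of `e` or `f`, which forces equal right ends or equal left ends respectively.
  Close⇒Meet : ∀ {e f} → Close (BoxComplex G) (atom e) (atom f) → Meet e f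
  Close⇒Meet {e} {f} (z , (e⊆σ , _) , (_ , f⊆τ) , only)
    with only {atom c} (atom-minimal c) ((λ { refl → e⊆σ refl }) , (λ { refl → f⊆τ refl }))
    where c = edge (left e) (right f) (Biclique.complete z (e⊆σ refl , f⊆τ refl))
  ... | inj₁ (_ , τ⊆) = suc zero , sym (τ⊆ refl)
  ... | inj₂ (σ⊆ , _) = zero , σ⊆ refl

-- The isomorphism of line graphs induced on minimal elements.

module _ {G : Graph a} {H : Graph b} (I : BoxComplex G ≅ᴾ BoxComplex H) where
  open PosetIso I
  private
    module B = Poset (BoxComplex G)
    module C = Poset (BoxComplex H)

  edgeTo : Edge G → Edge H
  edgeTo e = edgeIn (to (atom e))

  atom-edgeTo : ∀ e → atom (edgeTo e) C.≈ to (atom e)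
  atom-edgeTo e = atom-edgeIn {B = to (atom e)}
    (Minimal-to I {atom e} (atom-minimal e))

  edgeTo-cong : ∀ {e f} → e ≋ f → edgeTo e ≋ edgeTo f
  edgeTo-cong {e} {f} e≋f = atom-cancel
    (C.trans {atom (edgeTo e)} {to (atom e)} {atom (edgeTo f)}
      (C.reflexive {atom (edgeTo e)} {to (atom e)} (atom-edgeTo e))
      (C.trans {to (atom e)} {to (atom f)} {atom (edgeTo f)}
        (mono (atom-mono e≋f))
        (C.reflexive {to (atom f)} {atom (edgeTo f)}
          (C.Eq.sym {atom (edgeTo f)} {to (atom f)} (atom-edgeTo f)))))

  edgeTo-meet : ∀ {e f} → Meet e f → Meet (edgeTo e) (edgeTo f)
  edgeTo-meet {e} {f} meet = Close⇒Meet (Close-cong (BoxComplex H)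
    {to (atom e)} {atom (edgeTo e)} {to (atom f)} {atom (edgeTo f)}
    (C.Eq.sym {atom (edgeTo e)} {to (atom e)} (atom-edgeTo e))
    (C.Eq.sym {atom (edgeTo f)} {to (atom f)} (atom-edgeTo f))
    (Close-to I {atom e} {atom f} (Meet⇒Close meet)))

edgeTo-inverse : {G : Graph a} {H : Graph b} (I : BoxComplex G ≅ᴾ BoxComplex H) → ∀ e →
  edgeTo (≅ᴾ-sym I) (edgeTo I e) ≋ e
edgeTo-inverse {G = G} {H} I e = atom-cancel
  -- One inequality suffices, since comparable atoms have the same ends.
  (B.trans {atom (edgeTo J f)} {from (atom f)} {atom e}
    (B.reflexive {atom (edgeTo J f)} {from (atom f)} (atom-edgeTo J f))
    (≤-to⇒from-≤ {atom e} {atom f} (C.reflexive {atom f} {to (atom e)} (atom-edgeTo I e))))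
  where
  open PosetIso I
  module B = Poset (BoxComplex G)
  module C = Poset (BoxComplex H)
  J = ≅ᴾ-sym I
  f = edgeTo I e

line-graphs-isomorphic : {G : Graph a} {H : Graph b} →
  BoxComplex G ≅ᴾ BoxComplex H → LineIso G H
line-graphs-isomorphic {G = G} {H} I = record
  { inverse   = record
    { to        = edgeTo I
    ; from      = edgeTo J
    ; to-cong   = edgeTo-cong I
    ; from-cong = edgeTo-cong J
    ; inverse   =
        strictlyInverseˡ⇒inverseˡ (edgeTo-cong I) (edgeTo-inverse J)
      , strictlyInverseʳ⇒inverseʳ (edgeTo-cong J) (edgeTo-inverse I)
    }
  ; to-meet   = edgeTo-meet I
  ; from-meet = edgeTo-meet J
  }
  where
  J = ≅ᴾ-sym I
  open Consequences (edges G) (edges H)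
    using (strictlyInverseˡ⇒inverseˡ; strictlyInverseʳ⇒inverseʳ)

theorem1p1 : ∀ {ℓ} → ExcludedMiddle ℓ → (G H : Graph ℓ) →
    NoIsolatedVertices G → NoIsolatedVertices H →
    (K₂ ×ᴳ G ≅ᴳ K₂ ×ᴳ H) ⇔ (BoxComplex G ≅ᴾ BoxComplex H)
theorem1p1 em G H m n = mk⇔ box-complexes-isomorphic
  (VertexMap.double-coverings-isomorphic em m n ∘ line-graphs-isomorphic)
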